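{- Let $H$ be a graph. If $G$ is an $H$-graph, then $G$ has at most $(2|G|+1)^{\|H\|}+\|H\|\cdot(2|G|)^2$ minimal separators.
   Context: All graphs are finite, undirected, loopless, and may have multiple edges. $|G|$ and $\|G\|$ denote the numbers of vertices and of edges (counted with multiplicity) of $G$. Let $H$ be a (multi)graph. A graph $G$ is an $H$-graph if there are a subdivision $H'$ of $H$ and a collection $\mathcal{M}=\{M_v\}_{v\in V(G)}$ of non-empty subsets of $V(H')$, each inducing a connected subgraph of $H'$, such that $G$ is (isomorphic to) the intersection graph of $\mathcal{M}$. For $a,b\in V(G)$, a set $X\subseteq V(G)$ is an $(a,b)$-separator if $a$ and $b$ are in distinct connected components of $G\setminus X$; it is a minimal $(a,b)$-separator if it is inclusion-wise minimal with this property. A set $X\subseteq V(G)$ is a minimal separator of $G$ if it is a minimal $(a,b)$-separator for some $a,b\in V(G)$. -}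

module Defs where

open import Data.Fin using (Fin; zero; suc; inject₁)
open import Data.Fin.Properties using (suc-injective)
open import Data.Fin.Relation.Unary.Top using (View; view; ‵fromℕ; ‵inject₁)
open import Data.Fin.Subset using (Subset; _∉_; _⊂_)
open import Data.List using (List; length)
open import Data.List.Relation.Unary.All using (All)
open import Data.List.Relation.Unary.Unique.Propositional using (Unique)
open import Data.Nat using (ℕ; zero; suc; _≤_)
open import Data.Product using (Σ; ∃; ∃₂; _×_; _,_; proj₁; proj₂)
open import Data.Sum using (_⊎_; inj₁; inj₂)
open import Data.Sum.Properties using (inj₁-injective)
open import Function using (_∘_; _⇔_)
open import Level using (0ℓ)
open import Relation.Binary.Construct.Closure.ReflexiveTransitive using (Star)
open import Relation.Binary.PropositionalEquality using (_≡_; _≢_; refl)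
open import Relation.Nullary using (¬_)
open import Relation.Unary using (Pred; Decidable; Satisfiable; _≬_)

-- The order of the pair `ends e` carries no meaning: adjacency and paths
-- are defined through the symmetric relation `Joins`.
record Multigraph (V E : Set) : Set where
  field
    ends     : E → V × V
    loopless : ∀ e → proj₁ (ends e) ≢ proj₂ (ends e)

  Joins : E → V → V → Set
  Joins e u v = ends e ≡ (u , v) ⊎ ends e ≡ (v , u)

  Adjacent : V → V → Set
  Adjacent u v = ∃ λ e → Joins e u v

  Simple : Set
  Simple = ∀ {e f u v} → Joins e u v → Joins f u v → e ≡ f

  AdjacentIn : Pred V 0ℓ → V → V → Set
  AdjacentIn P u v = P u × P v × Adjacent u v

  -- The empty path is allowed at every vertex, so the ends of a path must be
  -- required to lie in P separately.
  PathIn : Pred V 0ℓ → V → V → Set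
  PathIn P = Star (AdjacentIn P)

  ConnectedIn : Pred V 0ℓ → Set
  ConnectedIn P = ∀ {u v} → P u → P v → PathIn P u v

Graph : ℕ → ℕ → Set
Graph n m = Multigraph (Fin n) (Fin m)

-- The subdivision of H in which each edge e = uv is replaced by a path with
-- s e inner vertices
--
--   u — (e , 0) — (e , 1) — ⋯ — (e , s e - 1) — v
--
-- whose i-th edge, for 0 ≤ i ≤ s e, goes from `left e i` to `right e i`.
module _ {h k : ℕ} (H : Graph h k) (s : Fin k → ℕ) where

  open Multigraph H

  SubdivisionVertex : Set
  SubdivisionVertex = Fin h ⊎ Σ (Fin k) (Fin ∘ s)

  SubdivisionEdge : Set
  SubdivisionEdge = Σ (Fin k) (Fin ∘ suc ∘ s)

  left : ∀ e → Fin (suc (s e)) → SubdivisionVertex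
  left e zero    = inj₁ (proj₁ (ends e))
  left e (suc i) = inj₂ (e , i)

  rightView : ∀ e {i : Fin (suc (s e))} → View i → SubdivisionVertex
  rightView e ‵fromℕ       = inj₁ (proj₂ (ends e))
  rightView e (‵inject₁ i) = inj₂ (e , i)

  right : ∀ e → Fin (suc (s e)) → SubdivisionVertex
  right e i = rightView e (view i)

  private
    suc≢inject₁ : ∀ {n} (i : Fin n) → suc i ≢ inject₁ i
    suc≢inject₁ (suc i) eq = suc≢inject₁ i (suc-injective eq)

    inner-injective : ∀ {e} {i j : Fin (s e)} →
                      _≡_ {A = SubdivisionVertex} (inj₂ (e , i)) (inj₂ (e , j)) → i ≡ j
    inner-injective refl = refl

    left≢rightView : ∀ e {i} (w : View i) → left e i ≢ rightView e w
    left≢rightView e {i} w eq = go i w refl eq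
      where
      go : ∀ i′ {i} (w : View i) → i′ ≡ i → left e i′ ≢ rightView e w
      go zero    ‵fromℕ       _  eq = loopless e (inj₁-injective eq)
      go (suc i) (‵inject₁ j) p eq with inner-injective eq
      ... | refl = suc≢inject₁ i p

  subdivision : Multigraph SubdivisionVertex SubdivisionEdge
  subdivision = record
    { ends     = λ (e , i) → left e i , right e i
    ; loopless = λ (e , i) → left≢rightView e (view i)
    }

-- The family is indexed by V(G) itself, so an isomorphism between G and the
-- intersection graph may be taken to be the identity on indices.
record IsIntersectionGraph {n m : ℕ} {A : Set} (M : Fin n → Pred A 0ℓ) (G : Graph n m) : Set where
  open Multigraph G
  field
    simple   : Simple
    adjacent : ∀ u v → Adjacent u v ⇔ (u ≢ v × M u ≬ M v)

-- A subset of the finite vertex set of the subdivision is a decidable predicate.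
record IsHGraph {h k n m : ℕ} (H : Graph h k) (G : Graph n m) : Set₁ where
  field
    s            : Fin k → ℕ
    M            : Fin n → Pred (SubdivisionVertex H s) 0ℓ
    decidable    : ∀ v → Decidable (M v)
    nonempty     : ∀ v → Satisfiable (M v)
    connected    : ∀ v → Multigraph.ConnectedIn (subdivision H s) (M v)
    intersection : IsIntersectionGraph M G

module _ {n m : ℕ} (G : Graph n m) where

  open Multigraph G

  Separator : Fin n → Fin n → Subset n → Set
  Separator a b X = a ∉ X × b ∉ X × ¬ PathIn (_∉ X) a b

  MinimalSeparatorBetween : Fin n → Fin n → Subset n → Set
  MinimalSeparatorBetween a b X = Separator a b X × (∀ Y → Y ⊂ X → ¬ Separator a b Y)

  MinimalSeparator : Subset n → Set
  MinimalSeparator X = ∃₂ λ a b → MinimalSeparatorBetween a b X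

AtMost : {A : Set} → ℕ → Pred A 0ℓ → Set
AtMost {A} N P = ∀ (xs : List A) → Unique xs → All P xs → length xs ≤ N

{-# OPTIONS --safe #-}

-- Let X be a minimal (a,b)-separator, C and D the components of G ∖ X that
-- contain a and b, and A and B the unions of the sets M u over u ∈ C and over
-- u ∈ D.  These are disjoint connected sets of the subdivision, and a vertex
-- belongs to X exactly when its model contains both ends of some edge leaving
-- A.  A connected set P has at most one edge of each orientation leaving it on
-- the path of a given edge e of H; since an edge leaving A on e also leaves
-- some M u, it is determined by u and its orientation: 2 n codes for each e.
--
-- If A and B both contain vertices of H, then those edges leaving A suffice
-- that lie on an edge of H with exactly one end in A; there is at most one
-- of them on every e, so (2 n + 1) ^ k codes are enough.  Otherwise A, say,
-- lies in the interior of one subdivided edge, and X is given by that edge and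
-- the two edges leaving A there: k (2 n) ^ 2 codes.

module Submission where

open import Defs
open import Data.Nat using (ℕ; zero; suc; _+_; _*_; _^_; _≤_; _<_; z≤n; s≤s; _≤?_)
open import Data.Nat.Properties using (≤-refl; <-irrefl; <-cmp; <⇒≤; ≤⇒≯; m≤n⇒m≤1+n; ≤∧≢⇒<; ≰⇒>)
open import Data.Empty using (⊥; ⊥-elim)
open import Data.Fin using (Fin; zero; suc; toℕ; fromℕ; inject₁; join; splitAt; combine; remQuot; funToFin; finToFun)
import Data.Fin.Properties as Fin
open import Data.Fin.Relation.Unary.Top using (view; ‵fromℕ; ‵inject₁; view-fromℕ; view-inject₁)
open import Data.Fin.Subset using (Subset; _∈_; _∉_; _-_; ⁅_⁆)
open import Data.Fin.Subset.Properties using (_∈?_; ⊆-antisym; p─q⊆p; x∈p⇒p-x⊂p; x∈p∧x≢y⇒x∈p-y)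
open import Data.List using (List; length; lookup)
import Data.List.Relation.Unary.All as All
open import Data.List.Relation.Unary.AllPairs using (_∷_)
open import Data.List.Relation.Unary.Unique.Propositional using (Unique)
open import Data.List.Membership.Propositional.Properties using (∈-lookup)
open import Data.Product using (∃; _×_; _,_; proj₁; proj₂)
import Data.Product.Properties as ×
open import Data.Sum using (_⊎_; inj₁; inj₂; [_,_]′)
open import Effect.Monad using (module RawMonad)
open import Function using (_∘_; _⇔_; mk⇔; Equivalence; case_of_)
open import Level using (0ℓ)
open import Relation.Binary using (tri<; tri≈; tri>)
open import Relation.Binary.Construct.Closure.ReflexiveTransitive using (ε; _◅_; _◅◅_; reverse)
open import Relation.Binary.PropositionalEquality using (_≡_; refl; sym; cong; subst)
open import Relation.Nullary using (¬_; Dec; yes; no; contradiction; _×-dec_; _⊎-dec_)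
open import Relation.Nullary.Decidable using (decidable-stable; ¬¬-excluded-middle)
open import Relation.Nullary.Negation using (¬¬-Monad; negated-stable)
open import Relation.Unary using (Pred; Decidable; Satisfiable; _≬_)

open Equivalence using (to; from)

-- Counting by codes.

¬¬-sequence : ∀ {n} {P : Pred (Fin n) 0ℓ} → (∀ i → ¬ ¬ P i) → ¬ ¬ (∀ i → P i)
¬¬-sequence = Fin.sequence (RawMonad.rawApplicative ¬¬-Monad)

module _ {A : Set} where

  lookup-injective : ∀ {xs : List A} → Unique xs → ∀ i j → lookup xs i ≡ lookup xs j → i ≡ j
  lookup-injective (_ ∷ _)  zero    zero    _  = refl
  lookup-injective (p ∷ _)  zero    (suc j) eq = contradiction eq (All.lookup p (∈-lookup j))
  lookup-injective (p ∷ _)  (suc i) zero    eq = contradiction (sym eq) (All.lookup p (∈-lookup i))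
  lookup-injective (_ ∷ xs) (suc i) (suc j) eq = cong suc (lookup-injective xs i j eq)

  -- Codes need only exist classically, as the bound itself is decidable.
  atMost-coded : ∀ {N} {P : Pred A 0ℓ} (Codes : Fin N → Pred A 0ℓ) →
                 (∀ {q x y} → Codes q x → Codes q y → x ≡ y) →
                 (∀ {x} → P x → ¬ ¬ (∃ λ q → Codes q x)) → AtMost N P
  atMost-coded {N} Codes functional coded xs unique ps =
    decidable-stable (length xs ≤? N) λ too-long →
    ¬¬-sequence (λ i → coded (All.lookup ps (∈-lookup i))) λ code →
    case Fin.pigeonhole (≰⇒> too-long) (proj₁ ∘ code) of λ where
      (i , j , i<j , eq) →
        Fin.<⇒≢ i<j (lookup-injective unique i j
          (functional (proj₂ (code i)) (subst (λ q → Codes q _) (sym eq) (proj₂ (code j)))))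

-- Paths in a multigraph and their exits from a set.

module _ {V E : Set} (G : Multigraph V E) where

  open Multigraph G

  Adjacent-sym : ∀ {u v} → Adjacent u v → Adjacent v u
  Adjacent-sym (e , inj₁ eq) = e , inj₂ eq
  Adjacent-sym (e , inj₂ eq) = e , inj₁ eq

  AdjacentIn-sym : ∀ {P u v} → AdjacentIn P u v → AdjacentIn P v u
  AdjacentIn-sym (pu , pv , uv) = pv , pu , Adjacent-sym uv

  PathIn-sym : ∀ {P u v} → PathIn P u v → PathIn P v u
  PathIn-sym {P} = reverse (AdjacentIn-sym {P})

  PathIn-map : ∀ {P Q : Pred V 0ℓ} → (∀ {x} → P x → Q x) → ∀ {u v} → PathIn P u v → PathIn Q u v
  PathIn-map f ε                    = ε
  PathIn-map f ((pu , pv , uv) ◅ p) = (f pu , f pv , uv) ◅ PathIn-map f p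

  PathIn-target : ∀ {P u v} → P u → PathIn P u v → P v
  PathIn-target pu ε                  = pu
  PathIn-target pu ((_ , pv , _) ◅ p) = PathIn-target pv p

  PathIn-reachable : ∀ {P a u v} → PathIn P a u → PathIn P u v → PathIn (PathIn P a) u v
  PathIn-reachable a⇝u ε       = ε
  PathIn-reachable a⇝u (s ◅ p) = (a⇝u , a⇝w , proj₂ (proj₂ s)) ◅ PathIn-reachable a⇝w p
    where a⇝w = a⇝u ◅◅ (s ◅ ε)

  reachable-connected : ∀ {P a} → ConnectedIn (PathIn P a)
  reachable-connected a⇝u a⇝v = PathIn-reachable a⇝u (PathIn-sym a⇝u ◅◅ a⇝v)

  -- The last exit is taken, not just any, so that the path avoids `P` from `outer` on; `escape`
  -- keeps this fact and forgets `Q`.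
  record LastExit (P Q : Pred V 0ℓ) (y : V) : Set where
    constructor lastExit
    field
      {edge}       : E
      {inner outer} : V
      joins        : Joins edge inner outer
      inner∈Q      : Q inner
      outer∈Q      : Q outer
      inner∈P      : P inner
      outer∉P      : ¬ P outer
      escape       : PathIn (¬_ ∘ P) outer y

  exits : ∀ {P Q x y} → Decidable P → P x → ¬ P y → PathIn Q x y → LastExit P Q y
  exits {P} {Q} {y = y} P? px ¬py p = [ (λ exit → exit) , (λ out → ⊥-elim (proj₁ out px)) ]′ (go p)
    where
    -- In the right-hand case the path meets `P` nowhere from `x` on.
    go : ∀ {x} → PathIn Q x y → LastExit P Q y ⊎ (¬ P x × PathIn (¬_ ∘ P) x y)
    go ε = inj₂ (¬py , ε)
    go {x} ((qx , qz , e , j) ◅ p) with go p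
    ... | inj₁ exit = inj₁ exit
    ... | inj₂ (¬pz , out) with P? x
    ...   | yes px = inj₁ (lastExit j qx qz px ¬pz out)
    ...   | no ¬px = inj₂ (¬px , (¬px , ¬pz , e , j) ◅ out)

-- Pairs and sequences split by a predicate.

-- A direction is an element of Fin 2, so that pairs of a direction and a vertex
-- are counted by Fin (2 * n).
Splits : ∀ {V : Set} → Pred V 0ℓ → Fin 2 → V → V → Set
Splits P zero       x y = P x × ¬ P y
Splits P (suc zero) x y = P y × ¬ P x

splits⇒¬both : ∀ {V : Set} (P : Pred V 0ℓ) d {x y} → Splits P d x y → ¬ (P x × P y)
splits⇒¬both P zero       (_ , ¬py) (_ , py) = ¬py py
splits⇒¬both P (suc zero) (_ , ¬px) (px , _) = ¬px px

splits-direction : ∀ {V : Set} {P : Pred V 0ℓ} d d′ {x y} → Splits P d x y → Splits P d′ x y → d ≡ d′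
splits-direction zero       zero       _        _        = refl
splits-direction zero       (suc zero) (p , _)  (_ , ¬p) = contradiction p ¬p
splits-direction (suc zero) zero       (p , _)  (_ , ¬p) = contradiction p ¬p
splits-direction (suc zero) (suc zero) _        _        = refl

splits? : ∀ {V : Set} {P : Pred V 0ℓ} {x y} → Dec (P x) → Dec (P y) → Dec (∃ λ d → Splits P d x y)
splits? (yes p) (no ¬q) = yes (zero , p , ¬q)
splits? (no ¬p) (yes q) = yes (suc zero , q , ¬p)
splits? (yes p) (yes q) = no λ (d , split) → splits⇒¬both _ d split (p , q)
splits? (no ¬p) (no ¬q) = no λ where
  (zero     , p , _) → ¬p p
  (suc zero , q , _) → ¬q q

-- The position where P must fail for P to be split in direction d.
extreme : ∀ {n} → Fin 2 → Fin (suc n)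
extreme zero       = fromℕ _
extreme (suc zero) = zero

-- A discrete intermediate value argument between `i` and `extreme d`. In direction `suc zero` the
-- failing position is the first, so it is dropped only once `P` is known to fail at the next one.
consecutive-split : ∀ {n} {P : Pred (Fin (suc n)) 0ℓ} → Decidable P → ∀ d {i} →
                    P i → ¬ P (extreme d) → ∃ λ t → Splits P d (inject₁ t) (suc t)
consecutive-split {zero}  P? zero       {zero}  p ¬p = contradiction p ¬p
consecutive-split {suc n} P? zero       {suc i} p ¬p with consecutive-split (P? ∘ suc) zero p ¬p
... | t , split = suc t , split
consecutive-split {suc n} P? zero       {zero}  p ¬p with P? (suc zero)
... | no  ¬p₁ = zero , p , ¬p₁
... | yes p₁ with consecutive-split (P? ∘ suc) zero p₁ ¬p
...   | t , split = suc t , split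
consecutive-split         P? (suc zero) {zero}  p ¬p = contradiction p ¬p
consecutive-split {suc n} P? (suc zero) {suc i} p ¬p with P? (suc zero)
... | yes p₁ = zero , p₁ , ¬p
... | no  ¬p₁ with consecutive-split (P? ∘ suc) (suc zero) p ¬p₁
...   | t , split = suc t , split

-- Edges of a subdivision that leave a connected set.

module _ {h k : ℕ} (H : Graph h k) (s : Fin k → ℕ) where

  private
    module H = Multigraph H
    V = SubdivisionVertex H s
    E = SubdivisionEdge H s

  open Multigraph (subdivision H s)

  source target : Fin k → V
  source e = inj₁ (proj₁ (H.ends e))
  target e = inj₁ (proj₂ (H.ends e))

  leftEnd rightEnd : E → V
  leftEnd  (e , i) = left H s e i
  rightEnd (e , i) = right H s e i

  right-fromℕ : ∀ e → rightEnd (e , fromℕ (s e)) ≡ target e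
  right-fromℕ e = cong (rightView H s e) (view-fromℕ (s e))

  right-inject₁ : ∀ e i → rightEnd (e , inject₁ i) ≡ inj₂ (e , i)
  right-inject₁ e i = cong (rightView H s e) (view-inject₁ i)

  -- `rightEnd` is stuck on `view i`; with its value as an index, one match reveals both the
  -- position and the vertex.
  data RightEnd (e : Fin k) : Fin (suc (s e)) → V → Set where
    end   : RightEnd e (fromℕ (s e)) (target e)
    inner : ∀ t → RightEnd e (inject₁ t) (inj₂ (e , t))

  rightEnd? : ∀ e i → RightEnd e i (rightEnd (e , i))
  rightEnd? e i with view i
  ... | ‵fromℕ     = end
  ... | ‵inject₁ t = inner t

  leftEnd-edge : ∀ {e i e′ t} → leftEnd (e , i) ≡ inj₂ (e′ , t) → e ≡ e′
  leftEnd-edge {i = suc i} refl = refl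

  rightEnd-edge : ∀ {e i e′ t} → rightEnd (e , i) ≡ inj₂ (e′ , t) → e ≡ e′
  rightEnd-edge {e} {i} eq with rightEnd (e , i) | rightEnd? e i
  rightEnd-edge refl | _ | inner t = refl

  -- The path of `e` with its ends included: edge `i` joins positions `i` and `i + 1`.
  vertexAt : ∀ e → Fin (suc (suc (s e))) → V
  vertexAt e zero    = source e
  vertexAt e (suc i) = rightEnd (e , i)

  left-vertexAt : ∀ e i → leftEnd (e , i) ≡ vertexAt e (inject₁ i)
  left-vertexAt e zero    = refl
  left-vertexAt e (suc i) = sym (right-inject₁ e i)

  Boundary : Pred V 0ℓ → Fin 2 → Pred E 0ℓ
  Boundary P d f = Splits P d (leftEnd f) (rightEnd f)

  boundary-at : ∀ {P} → Decidable P → ∀ d {e} p → P (vertexAt e p) → ¬ P (vertexAt e (extreme d)) →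
                ∃ λ i → Boundary P d (e , i)
  boundary-at {P} P? d {e} i p ¬p with consecutive-split (P? ∘ vertexAt e) d {i} p ¬p
  ... | j , split = j , shift d split
    where
    shift : ∀ d → Splits (P ∘ vertexAt e) d (inject₁ j) (suc j) → Boundary P d (e , j)
    shift zero       (p , ¬p) = subst P (sym (left-vertexAt e j)) p , ¬p
    shift (suc zero) (p , ¬p) = p , ¬p ∘ subst P (left-vertexAt e j)

  boundary-of-split : ∀ {P} → Decidable P → ∀ d {e} → Splits P d (source e) (target e) →
                      ∃ λ i → Boundary P d (e , i)
  boundary-of-split {P} P? zero       {e} (p , ¬p) =
    boundary-at P? zero zero p (¬p ∘ subst P (right-fromℕ e))
  boundary-of-split {P} P? (suc zero) {e} (p , ¬p) =
    boundary-at P? (suc zero) (fromℕ (suc (s e))) (subst P (sym (right-fromℕ e)) p) ¬p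

  -- The inner vertex t lies between the edges t and t + 1 of the path of e.
  Between : ∀ e → (lo hi : Fin (suc (s e))) → Pred V 0ℓ
  Between e lo hi x = ∃ λ t → x ≡ inj₂ (e , t) × toℕ lo ≤ toℕ t × toℕ t < toℕ hi

  between-leftEnd : ∀ {e lo hi i} → toℕ lo < toℕ i → toℕ i ≤ toℕ hi → Between e lo hi (leftEnd (e , i))
  between-leftEnd {i = suc t} (s≤s lo≤t) t<hi = t , refl , lo≤t , t<hi

  between-leftEnd⁻¹ : ∀ {e lo hi i} → Between e lo hi (leftEnd (e , i)) → toℕ lo < toℕ i
  between-leftEnd⁻¹ {i = suc t} (.t , refl , lo≤t , _) = s≤s lo≤t

  between-rightEnd : ∀ {e lo hi i} → toℕ lo ≤ toℕ i → toℕ i < toℕ hi → Between e lo hi (rightEnd (e , i))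
  between-rightEnd {e} {lo} {hi} {i} lo≤i i<hi with rightEnd (e , i) | rightEnd? e i
  -- Here `i` is `s e`, the largest value that `hi` can take.
  ... | _ | end     = contradiction i<hi (≤⇒≯ (subst (toℕ hi ≤_) (sym (Fin.toℕ-fromℕ (s e))) (Fin.toℕ≤pred[n] hi)))
  ... | _ | inner t = t , refl , subst (toℕ lo ≤_) (Fin.toℕ-inject₁ t) lo≤i ,
                      subst (_< toℕ hi) (Fin.toℕ-inject₁ t) i<hi

  between-rightEnd⁻¹ : ∀ {e lo hi i} → Between e lo hi (rightEnd (e , i)) → toℕ i < toℕ hi
  between-rightEnd⁻¹ {e} {i = i} b with rightEnd (e , i) | rightEnd? e i
  between-rightEnd⁻¹ {hi = hi} (.t , refl , _ , t<hi) | _ | inner t =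
    subst (_< toℕ hi) (sym (Fin.toℕ-inject₁ t)) t<hi
  between-rightEnd⁻¹ (_ , () , _) | _ | end

  -- The stretch between `lo` and `hi` can be left only across one of these two edges, and neither
  -- has both ends in `Q`.
  between-step : ∀ {Q e lo hi x y} →
                 ¬ (Q (leftEnd (e , lo)) × Q (rightEnd (e , lo))) →
                 ¬ (Q (leftEnd (e , hi)) × Q (rightEnd (e , hi))) →
                 AdjacentIn Q x y → Between e lo hi x → Between e lo hi y
  between-step ¬lo ¬hi (_ , _ , (_ , zero) , inj₁ refl) (_ , () , _)
  between-step {e = e} {lo} {hi} ¬lo ¬hi (qx , qy , (_ , suc i) , inj₁ refl) (.i , refl , lo≤i , i<hi) =
    between-rightEnd (m≤n⇒m≤1+n lo≤i) (≤∧≢⇒< i<hi λ eq → case Fin.toℕ-injective {i = suc i} {hi} eq of λ where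
      refl → ¬hi (qx , qy))
  between-step {Q} {e} {lo} {hi} ¬lo ¬hi (qx , qy , (e′ , i) , inj₂ refl) b@(t , eq , lo≤t , t<hi)
    with rightEnd (e′ , i) | rightEnd? e′ i | eq
  ... | _ | inner .t | refl =
    between-leftEnd
      (≤∧≢⇒< (subst (toℕ lo ≤_) (sym (Fin.toℕ-inject₁ t)) lo≤t)
        λ eq → case Fin.toℕ-injective {i = lo} eq of λ where
          refl → ¬lo (qy , subst Q (sym (right-inject₁ e t)) qx))
      (subst (_≤ toℕ hi) (sym (Fin.toℕ-inject₁ t)) (<⇒≤ t<hi))

  between-path : ∀ {Q e lo hi x y} →
                 ¬ (Q (leftEnd (e , lo)) × Q (rightEnd (e , lo))) →
                 ¬ (Q (leftEnd (e , hi)) × Q (rightEnd (e , hi))) →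
                 PathIn Q x y → Between e lo hi x → Between e lo hi y
  between-path ¬lo ¬hi ε        b = b
  between-path ¬lo ¬hi (st ◅ p) b = between-path ¬lo ¬hi p (between-step ¬lo ¬hi st b)

  -- Of two edges leaving `P` in the same direction, one has its end in `P` on the stretch between
  -- them and the other has it off that stretch. A path in `P` can cross neither edge, so it cannot
  -- join these ends.
  boundary-¬< : ∀ {P} → ConnectedIn P → ∀ d {e i j} → Boundary P d (e , i) → Boundary P d (e , j) →
                ¬ (toℕ i < toℕ j)
  boundary-¬< {P} con zero       bi bj i<j = <-irrefl refl (between-leftEnd⁻¹
    (between-path (splits⇒¬both P zero bi) (splits⇒¬both P zero bj) (con (proj₁ bj) (proj₁ bi))
      (between-leftEnd i<j ≤-refl)))
  boundary-¬< {P} con (suc zero) bi bj i<j = <-irrefl refl (between-rightEnd⁻¹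
    (between-path (splits⇒¬both P (suc zero) bi) (splits⇒¬both P (suc zero) bj) (con (proj₁ bi) (proj₁ bj))
      (between-rightEnd ≤-refl i<j)))

  boundary-unique : ∀ {P} → ConnectedIn P → ∀ d {e i j} → Boundary P d (e , i) → Boundary P d (e , j) → i ≡ j
  boundary-unique con d {i = i} {j} bi bj with <-cmp (toℕ i) (toℕ j)
  ... | tri< i<j _ _ = contradiction i<j (boundary-¬< con d bi bj)
  ... | tri≈ _ i≡j _ = Fin.toℕ-injective i≡j
  ... | tri> _ _ j<i = contradiction j<i (boundary-¬< con d bj bi)

  -- The path cannot cross edge `i`. Were the source outside `Q`, it could not cross the first edge
  -- of `e` either and would never reach a vertex of `H`. `Q` need not be decidable, hence the
  -- double negation.
  reaches-source : ∀ {Q e i w} → PathIn Q (leftEnd (e , i)) (inj₁ w) → Q (leftEnd (e , i)) →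
                   ¬ Q (rightEnd (e , i)) → ¬ ¬ Q (source e)
  reaches-source {i = zero}  p q ¬q ¬src = ¬src q
  reaches-source {i = suc i} p q ¬q ¬src
    with between-path {lo = zero} (¬src ∘ proj₁) (¬q ∘ proj₂) p (between-leftEnd (s≤s z≤n) ≤-refl)
  ... | _ , () , _

  reaches-target : ∀ {Q e i w} → PathIn Q (rightEnd (e , i)) (inj₁ w) → Q (rightEnd (e , i)) →
                   ¬ Q (leftEnd (e , i)) → ¬ ¬ Q (target e)
  reaches-target {Q} {e} {i} p q ¬q ¬tgt with i Fin.≟ fromℕ (s e)
  ... | yes refl = ¬tgt (subst Q (right-fromℕ e) q)
  ... | no i≢top
    with between-path {hi = fromℕ (s e)} (¬q ∘ proj₁) (¬tgt ∘ subst Q (right-fromℕ e) ∘ proj₂) p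
           (between-rightEnd ≤-refl (≤∧≢⇒< (subst (toℕ i ≤_) (sym (Fin.toℕ-fromℕ (s e))) (Fin.toℕ≤pred[n] i))
             (i≢top ∘ Fin.toℕ-injective)))
  ...   | _ , () , _

  -- As `P` contains no vertex of `H`, a path in `P` crosses neither the first nor the last edge on
  -- the path of `e`.
  same-edge : ∀ {P} → ConnectedIn P → (∀ w → ¬ P (inj₁ w)) → ∀ {e t e′ t′} →
              P (inj₂ (e , t)) → P (inj₂ (e′ , t′)) → e ≡ e′
  same-edge {P} con ¬branch {e} {t} p p′
    with between-path {lo = zero} {hi = fromℕ (s e)} (¬branch _ ∘ proj₁)
           (¬branch _ ∘ subst P (right-fromℕ e) ∘ proj₂) (con p p′)
           (t , refl , z≤n , subst (toℕ t <_) (sym (Fin.toℕ-fromℕ (s e))) (Fin.toℕ<n t))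
  ... | _ , refl , _ = refl

-- Full components of a minimal separator.

module _ {n m : ℕ} (G : Graph n m) where

  open Multigraph G

  Adjacent? : ∀ u v → Dec (Adjacent u v)
  Adjacent? u v = Fin.any? λ e → ends e ≟ (u , v) ⊎-dec ends e ≟ (v , u)
    where _≟_ = ×.≡-dec Fin._≟_ Fin._≟_

  -- The usual notion of a full component of `G` minus `X`. The vertex it is grown from is
  -- forgotten, so that both sides of a separator are treated alike.
  record FullComponent (X : Subset n) (C : Pred (Fin n) 0ℓ) : Set where
    field
      decide    : Decidable C
      inhabited : Satisfiable C
      joined    : ConnectedIn C
      avoids    : ∀ {v} → C v → v ∉ X
      closed    : ∀ {u v} → C u → Adjacent u v → v ∉ X → C v
      full      : ∀ {v} → v ∈ X → ∃ λ u → C u × Adjacent u v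

  separator-sym : ∀ {a b X} → Separator G a b X → Separator G b a X
  separator-sym (a∉X , b∉X , ¬path) = b∉X , a∉X , ¬path ∘ PathIn-sym G

  minimal-sym : ∀ {a b X} → MinimalSeparatorBetween G a b X → MinimalSeparatorBetween G b a X
  minimal-sym (sep , minimal) = separator-sym sep , λ Y Y⊂X → minimal Y Y⊂X ∘ separator-sym

  -- If some `v` in `X` had no neighbour in the component, `X - v` would still separate: a path
  -- avoiding it could not step from the component to `v`, so it would stay in the component.
  minimal⇒full : ∀ {a b X} → MinimalSeparatorBetween G a b X → Decidable (PathIn (_∉ X) a) →
                 FullComponent X (PathIn (_∉ X) a)
  minimal⇒full {a} {b} {X} ((a∉X , b∉X , ¬path) , minimal) C? = record
    { decide    = C?
    ; inhabited = a , ε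
    ; joined    = reachable-connected G
    ; avoids    = avoids
    ; closed    = closed
    ; full      = full
    }
    where
    C = PathIn (_∉ X) a

    avoids : ∀ {v} → C v → v ∉ X
    avoids = PathIn-target G a∉X

    closed : ∀ {u v} → C u → Adjacent u v → v ∉ X → C v
    closed cu uv v∉X = cu ◅◅ ((avoids cu , v∉X , uv) ◅ ε)

    full : ∀ {v} → v ∈ X → ∃ λ u → C u × Adjacent u v
    full {v} v∈X with Fin.any? (λ u → C? u ×-dec Adjacent? u v)
    ... | yes found = found
    ... | no ¬found =
      contradiction (∉-minus a∉X , ∉-minus b∉X , ¬path ∘ stays ε) (minimal (X - v) (x∈p⇒p-x⊂p v∈X))
      where
      ∉-minus : ∀ {u} → u ∉ X → u ∉ X - v
      ∉-minus u∉X = u∉X ∘ p─q⊆p X ⁅ v ⁆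

      stays : ∀ {u w} → C u → PathIn (_∉ X - v) u w → C w
      stays cu ε                          = cu
      stays {u} cu (_◅_ {j = w} (_ , w∉ , uw) p) with w Fin.≟ v
      ... | yes refl = contradiction (u , cu , uw) ¬found
      ... | no  w≢v  = stays (closed cu uw λ w∈X → w∉ (x∈p∧x≢y⇒x∈p-y w∈X w≢v)) p

-- Regions, codes for sets of edges, and the separators they determine.

module _ {h k n m : ℕ} (H : Graph h k) (G : Graph n m) (isHGraph : IsHGraph H G) where

  open IsHGraph isHGraph
  open IsIntersectionGraph intersection using (adjacent)
  open FullComponent

  private
    module G = Multigraph G
    module S = Multigraph (subdivision H s)
    V = SubdivisionVertex H s
    E = SubdivisionEdge H s

  Region : Pred (Fin n) 0ℓ → Pred V 0ℓ
  Region C x = ∃ λ u → C u × M u x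

  Crosses : Fin n → E → Set
  Crosses v f = M v (leftEnd H s f) × M v (rightEnd H s f)

  Leaves : Pred (Fin n) 0ℓ → Fin 2 → Pred E 0ℓ
  Leaves C = Boundary H s (Region C)

  region? : ∀ {C} → Decidable C → Decidable (Region C)
  region? C? x = Fin.any? λ u → C? u ×-dec decidable u x

  -- Consecutive vertices on a path in `C` have models that share a vertex, so paths inside the
  -- models can be concatenated.
  region-connected : ∀ {C} → G.ConnectedIn C → S.ConnectedIn (Region C)
  region-connected {C} con (u , cu , mx) (v , cv , my) = go cu (con cu cv) mx my
    where
    go : ∀ {u v x y} → C u → G.PathIn C u v → M u x → M v y → S.PathIn (Region C) x y
    go {u} cu ε mx my = PathIn-map (subdivision H s) (λ mz → u , cu , mz) (connected u mx my)
    go {u} cu ((_ , cw , uw) ◅ p) mx my with to (adjacent _ _) uw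
    ... | _ , z , mz , mz′ = PathIn-map (subdivision H s) (λ mz → u , cu , mz) (connected u mx mz) ◅◅ go cw p mz′ my

  -- The inner end lies in some `M u`; the outer end is outside the whole union, hence outside
  -- `M u`.
  leaves-model : ∀ {C} d {f} → Leaves C d f → ∃ λ u → Boundary H s (M u) d f
  leaves-model zero       ((u , cu , mu) , ¬r) = u , mu , λ mu′ → ¬r (u , cu , mu′)
  leaves-model (suc zero) ((u , cu , mu) , ¬r) = u , mu , λ mu′ → ¬r (u , cu , mu′)

  -- A code is a direction and a vertex of `G`. As models are connected, it names at most one edge
  -- on each path of the subdivision, without mentioning a position; so the number of codes does not
  -- depend on `s`.
  Turn : Fin (2 * n) → Pred E 0ℓ
  Turn c = Boundary H s (M (proj₂ (remQuot {2} n c))) (proj₁ (remQuot {2} n c))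

  -- Both predicates hold at `i`, and each holds for at most one edge on the path of `e`, so they
  -- agree on that path.
  turn-code : ∀ {C} → G.ConnectedIn C → ∀ d {e i} → Leaves C d (e , i) →
              ∃ λ c → ∀ j → Turn c (e , j) ⇔ Leaves C d (e , j)
  turn-code {C} con d {e} {i} leaves with leaves-model d leaves
  ... | u , boundary = combine d u , λ j → subst
    (λ (d′ , u′) → Boundary H s (M u′) d′ (e , j) ⇔ Leaves C d (e , j))
    (sym (Fin.remQuot-combine d u))
    (mk⇔
      (λ b → subst (λ i → Leaves C d (e , i)) (boundary-unique H s (connected u) d boundary b) leaves)
      (λ l → subst (λ i → Boundary H s (M u) d (e , i))
        (boundary-unique H s (region-connected con) d leaves l) boundary))

  -- The one additional code selects no edge.
  OptionalTurn : Fin (2 * n + 1) → Pred E 0ℓ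
  OptionalTurn c f = [ (λ t → Turn t f) , (λ _ → ⊥) ]′ (splitAt (2 * n) c)

  TurnPerEdge : Fin ((2 * n + 1) ^ k) → Pred E 0ℓ
  TurnPerEdge q (e , i) = OptionalTurn (finToFun q e) (e , i)

  -- The exponent 2 counts directions: `ts` encodes a function from directions to turns.
  TurnsAt : Fin k × Fin ((2 * n) ^ 2) → Pred E 0ℓ
  TurnsAt (e′ , ts) (e , i) = e ≡ e′ × ∃ λ d → Turn (finToFun {2 * n} {2} ts d) (e , i)

  TurnsOnEdge : Fin (k * (2 * n) ^ 2) → Pred E 0ℓ
  TurnsOnEdge q = TurnsAt (remQuot ((2 * n) ^ 2) q)

  Selected : Fin ((2 * n + 1) ^ k + k * (2 * n) ^ 2) → Pred E 0ℓ
  Selected q = [ TurnPerEdge , TurnsOnEdge ]′ (splitAt ((2 * n + 1) ^ k) q)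

  -- `F` determines `X`, so counting separators reduces to counting the sets `F`.
  Cuts : Pred E 0ℓ → Subset n → Set
  Cuts F X = ∀ v → v ∈ X ⇔ ∃ λ f → F f × Crosses v f

  cuts-functional : ∀ {F X Y} → Cuts F X → Cuts F Y → X ≡ Y
  cuts-functional cX cY = ⊆-antisym (λ {v} → from (cY v) ∘ to (cX v)) (λ {v} → from (cX v) ∘ to (cY v))

  cuts-resp : ∀ {F F′ X} → (∀ f → F f ⇔ F′ f) → Cuts F′ X → Cuts F X
  cuts-resp F⇔F′ cuts v = mk⇔
    (λ v∈X → case to (cuts v) v∈X of λ (f , sel , cross) → f , from (F⇔F′ f) sel , cross)
    (λ (f , sel , cross) → from (cuts v) (f , to (F⇔F′ f) sel , cross))

  turnPerEdge-code : (F : Pred E 0ℓ) → (∀ e → ∃ λ c → ∀ i → OptionalTurn c (e , i) ⇔ F (e , i)) →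
                     ∃ λ q → ∀ f → Selected q f ⇔ F f
  turnPerEdge-code F code =
    join ((2 * n + 1) ^ k) _ (inj₁ q) , λ (e , i) →
      subst (λ z → [ TurnPerEdge , TurnsOnEdge ]′ z (e , i) ⇔ F (e , i))
        (sym (Fin.splitAt-join ((2 * n + 1) ^ k) _ (inj₁ q)))
        (subst (λ c → OptionalTurn c (e , i) ⇔ F (e , i))
          (sym (Fin.finToFun-funToFin (proj₁ ∘ code) e)) (proj₂ (code e) i))
    where q = funToFin (proj₁ ∘ code)

  turnsOnEdge-code : (F : Pred E 0ℓ) → ∀ e → (t : Fin 2 → Fin (2 * n)) →
                     (∀ e′ i → (e′ ≡ e × ∃ λ d → Turn (t d) (e′ , i)) ⇔ F (e′ , i)) →
                     ∃ λ q → ∀ f → Selected q f ⇔ F f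
  turnsOnEdge-code F e t spec =
    join ((2 * n + 1) ^ k) _ (inj₂ q) , λ (e′ , i) →
      subst (λ z → [ TurnPerEdge , TurnsOnEdge ]′ z (e′ , i) ⇔ F (e′ , i))
        (sym (Fin.splitAt-join ((2 * n + 1) ^ k) _ (inj₂ q)))
        (at e′ i)
    where
    q = combine e (funToFin t)

    at : ∀ e′ i → TurnsOnEdge q (e′ , i) ⇔ F (e′ , i)
    at e′ i = subst (λ z → TurnsAt z (e′ , i) ⇔ F (e′ , i)) (sym (Fin.remQuot-combine e (funToFin t))) (mk⇔
      (λ (e′≡e , d , turn) → to (spec e′ i)
        (e′≡e , d , subst (λ c → Turn c (e′ , i)) (Fin.finToFun-funToFin t d) turn))
      (λ Ff → case from (spec e′ i) Ff of λ (e′≡e , d , turn) →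
        e′≡e , d , subst (λ c → Turn c (e′ , i)) (sym (Fin.finToFun-funToFin t d)) turn))

  -- Intersecting models make `v` equal or adjacent to a vertex of `C`, and `C` is closed under
  -- adjacency outside `X`.
  absorb : ∀ {X C} → FullComponent G X C → ∀ {v x} → Region C x → M v x → v ∉ X → C v
  absorb comp {v} (u , cu , ux) vx v∉X with u Fin.≟ v
  ... | yes refl = cu
  ... | no u≢v   = closed comp cu (from (adjacent u v) (u≢v , _ , ux , vx)) v∉X

  -- Outside `X`, `v` would be absorbed into `C` at the inner end, and its model would then put the
  -- outer end into the region.
  crosses-leaving⇒∈ : ∀ {X C} → FullComponent G X C → ∀ d {f v} → Leaves C d f → Crosses v f → v ∈ X
  crosses-leaving⇒∈ {X} comp d {f} {v} leaves (vl , vr) =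
    decidable-stable (v ∈? X) (outside d leaves)
    where
    outside : ∀ d → Leaves _ d f → ¬ (v ∉ X)
    outside zero       (r , ¬r) v∉X = ¬r (v , absorb comp r vl v∉X , vr)
    outside (suc zero) (r , ¬r) v∉X = ¬r (v , absorb comp r vr v∉X , vl)

  touches : ∀ {X C} → FullComponent G X C → ∀ {v} → v ∈ X → Region C ≬ M v
  touches comp v∈X with full comp v∈X
  ... | u , cu , uv with to (adjacent _ _) uv
  ...   | _ , x , ux , vx = x , (u , cu , ux) , vx

  joins-leaves : ∀ {C f x y} → S.Joins f x y → ∃ λ d → Region C x → ¬ Region C y → Leaves C d f
  joins-leaves (inj₁ refl) = zero     , _,_
  joins-leaves (inj₂ refl) = suc zero , _,_

  joins-cross : ∀ {f v x y} → S.Joins f x y → M v x → M v y → Crosses v f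
  joins-cross (inj₁ refl) vx vy = vx , vy
  joins-cross (inj₂ refl) vx vy = vy , vx

  -- Encoding a separator by the edges leaving one of its regions.

  module _ {X C D} (comp : FullComponent G X C) (other : FullComponent G X D)
           (disjoint : ∀ {v} → C v → ¬ D v) where

    regions-disjoint : ∀ {x} → Region D x → ¬ Region C x
    regions-disjoint (u , du , ux) rx = disjoint (absorb comp rx ux (avoids other du)) du

    -- By fullness the model of `v` meets both regions; it is connected and they are disjoint, so a
    -- path inside it leaves `Region C`.
    exit : ∀ {v} → v ∈ X → ∃ λ y → Region D y × LastExit (subdivision H s) (Region C) (M v) y
    exit v∈X with touches comp v∈X | touches other v∈X
    ... | x , rx , vx | y , ry , vy =
      y , ry , exits _ (region? (decide comp)) rx (regions-disjoint ry) (connected _ vx vy)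

    -- Walking from a vertex of the region towards either end of `e` must leave it, which provides a
    -- turn in each direction; all leaving edges lie on the path of `e`, so these two are all of
    -- them.
    cuts-within-edge : (∀ w → ¬ Region C (inj₁ w)) → ∃ λ q → Cuts (Selected q) X
    cuts-within-edge ¬branch with inhabited comp
    ... | u , cu with nonempty u
    ...   | inj₁ w , mw = contradiction (u , cu , mw) (¬branch w)
    ...   | inj₂ (e , t) , mt = proj₁ code , cuts-resp (proj₂ code) cuts
      where
      F : Pred E 0ℓ
      F f = ∃ λ d → Leaves C d f

      ¬extreme : ∀ d → ¬ Region C (vertexAt H s e (extreme d))
      ¬extreme zero       = ¬branch _ ∘ subst (Region C) (right-fromℕ H s e)
      ¬extreme (suc zero) = ¬branch _

      leaving : ∀ d → ∃ λ i → Leaves C d (e , i)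
      -- Position 0 is the source, so the inner vertex `t` has position `t + 1`.
      leaving d = boundary-at H s (region? (decide comp)) d (suc (inject₁ t))
        (subst (Region C) (sym (right-inject₁ H s e t)) (u , cu , mt)) (¬extreme d)

      turn : ∀ d → ∃ λ c → ∀ j → Turn c (e , j) ⇔ Leaves C d (e , j)
      turn d = turn-code (joined comp) d (proj₂ (leaving d))

      on-edge : ∀ {x} → Region C x → ∃ λ t′ → x ≡ inj₂ (e , t′)
      on-edge {inj₁ w}         rx = contradiction rx (¬branch w)
      on-edge {inj₂ (e′ , t′)} rx
        with same-edge H s (region-connected (joined comp)) ¬branch (u , cu , mt) rx
      ... | refl = t′ , refl

      leaves-on-edge : ∀ d {e′ i} → Leaves C d (e′ , i) → e′ ≡ e
      leaves-on-edge zero       (r , _) = leftEnd-edge H s (proj₂ (on-edge r))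
      leaves-on-edge (suc zero) (r , _) = rightEnd-edge H s (proj₂ (on-edge r))

      code : ∃ λ q → ∀ f → Selected q f ⇔ F f
      code = turnsOnEdge-code F e (proj₁ ∘ turn) λ e′ i → mk⇔
        (λ where (refl , d , t) → d , to (proj₂ (turn d) i) t)
        (λ (d , leaves) → case leaves-on-edge d leaves of λ where
          refl → refl , d , from (proj₂ (turn d) i) leaves)

      cuts : Cuts F X
      cuts v = mk⇔
        (λ v∈X → case exit v∈X of λ (_ , _ , lastExit j vi vo ri ¬ro _) →
          case joins-leaves j of λ (d , split) → _ , (d , split ri ¬ro) , joins-cross j vi vo)
        (λ (f , (d , leaves) , cross) → crosses-leaving⇒∈ comp d leaves cross)

    -- An edge of `H` with both ends in the region can carry two leaving edges. `F` discards these,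
    -- which is harmless because a last exit never lies there.
    cuts-across : ∀ {x y} → Region C (inj₁ x) → Region D (inj₁ y) → ∃ λ q → Cuts (Selected q) X
    cuts-across {x} {y} rx ry = proj₁ code , cuts-resp (proj₂ code) cuts
      where
      R? : Decidable (Region C)
      R? = region? (decide comp)

      F : Pred E 0ℓ
      F (e , i) = ∃ λ d → Splits (Region C) d (source H s e) (target H s e) × Leaves C d (e , i)

      turn : ∀ e → ∃ λ c → ∀ i → OptionalTurn c (e , i) ⇔ F (e , i)
      turn e with splits? (R? (source H s e)) (R? (target H s e))
      -- `F` has no edge on this path, so the empty code is used.
      ... | no ¬split = join (2 * n) 1 (inj₂ zero) , λ i →
        subst (λ z → [ (λ t → Turn t (e , i)) , (λ _ → ⊥) ]′ z ⇔ F (e , i))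
          (sym (Fin.splitAt-join (2 * n) 1 (inj₂ zero)))
          (mk⇔ ⊥-elim λ (d , split , _) → ¬split (d , split))
      ... | yes (d , split) with turn-code (joined comp) d (proj₂ (boundary-of-split H s R? d split))
      ...   | c , spec = join (2 * n) 1 (inj₁ c) , λ i →
        subst (λ z → [ (λ t → Turn t (e , i)) , (λ _ → ⊥) ]′ z ⇔ F (e , i))
          (sym (Fin.splitAt-join (2 * n) 1 (inj₁ c)))
          (mk⇔ (λ t → d , split , to (spec i) t)
               (λ (d′ , split′ , leaves) → from (spec i)
                 (subst (λ d → Leaves C d (e , i)) (splits-direction d′ d split′ split) leaves)))

      code : ∃ λ q → ∀ f → Selected q f ⇔ F f
      code = turnPerEdge-code F turn

      to-x : ∀ {z} → Region C z → S.PathIn (Region C) z (inj₁ x)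
      to-x rz = region-connected (joined comp) rz rx

      avoiding-to-y : ∀ {z} → Region D z → S.PathIn (¬_ ∘ Region C) z (inj₁ y)
      avoiding-to-y rz = PathIn-map (subdivision H s) regions-disjoint (region-connected (joined other) rz ry)

      -- The inner end reaches `x` inside the region, so the end of `e` on its side is in the
      -- region. The outer end reaches `y` outside the region, so the other end of `e` is not.
      exit-F : ∀ {f u v} → S.Joins f u v → Region C u → ¬ Region C v →
               S.PathIn (¬_ ∘ Region C) v (inj₁ y) → F f
      exit-F {e , i} (inj₁ refl) ru ¬rv p =
        zero ,
        ( decidable-stable (R? _) (reaches-source H s (to-x ru) ru ¬rv)
        , negated-stable (reaches-target H s p ¬rv (contradiction ru))) ,
        ru , ¬rv
      exit-F {e , i} (inj₂ refl) ru ¬rv p =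
        suc zero ,
        ( decidable-stable (R? _) (reaches-target H s (to-x ru) ru ¬rv)
        , negated-stable (reaches-source H s p ¬rv (contradiction ru))) ,
        ru , ¬rv

      cuts : Cuts F X
      cuts v = mk⇔
        (λ v∈X → case exit v∈X of λ (_ , rz , lastExit j vi vo ri ¬ro p) →
          _ , exit-F j ri ¬ro (p ◅◅ avoiding-to-y rz) , joins-cross j vi vo)
        (λ (f , (d , _ , leaves) , cross) → crosses-leaving⇒∈ comp d leaves cross)

  -- Membership in `C` and `D` is not decided by any search; since the goal is a negation, excluded
  -- middle may be assumed for each of the finitely many vertices.
  minimal-coded : ∀ {X} → MinimalSeparator G X → ¬ ¬ (∃ λ q → Cuts (Selected q) X)
  minimal-coded {X} (a , b , minimal) ¬coded =
    ¬¬-sequence (λ v → ¬¬-excluded-middle {A = C v}) λ C? →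
    ¬¬-sequence (λ v → ¬¬-excluded-middle {A = D v}) λ D? →
    ¬coded (encode (minimal⇒full G minimal C?) (minimal⇒full G (minimal-sym G minimal) D?))
    where
    C D : Pred (Fin n) 0ℓ
    C = G.PathIn (_∉ X) a
    D = G.PathIn (_∉ X) b

    disjoint : ∀ {v} → C v → ¬ D v
    disjoint a⇝v b⇝v = proj₂ (proj₂ (proj₁ minimal)) (a⇝v ◅◅ PathIn-sym G b⇝v)

    encode : FullComponent G X C → FullComponent G X D → ∃ λ q → Cuts (Selected q) X
    encode comp other
      with Fin.any? (region? (decide comp) ∘ inj₁) | Fin.any? (region? (decide other) ∘ inj₁)
    ... | yes (_ , rx) | yes (_ , ry) = cuts-across comp other disjoint rx ry
    ... | no ¬branch   | _            = cuts-within-edge comp other disjoint λ w r → ¬branch (w , r)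
    ... | _            | no ¬branch   =
      -- The components exchange roles; `Cuts` speaks of `X` alone, so the same codes serve.
      cuts-within-edge other comp (λ dv cv → disjoint cv dv) λ w r → ¬branch (w , r)

theorem6 : ∀ {h k n m : ℕ} (H : Graph h k) (G : Graph n m) → IsHGraph H G →
    AtMost ((2 * n + 1) ^ k + k * (2 * n) ^ 2) (MinimalSeparator G)
theorem6 H G isHGraph =
  atMost-coded (λ q → Cuts H G isHGraph (Selected H G isHGraph q))
    (cuts-functional H G isHGraph) (minimal-coded H G isHGraph)
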